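{- Let $G=(V,E)$ be an undirected graph with $n$ nodes and $m$ edges. Let $H$ be the set of nodes with degree larger than $m^{1/3}$, and $L=V\setminus H$. Orient every edge $\{u,v\}$ from $u$ to $v$ if $\deg(u)\le \deg(v)$ (breaking ties arbitrarily). Let $P$ be the number of directed $2$-paths $u\to v\to w$ with $u\in L$, $v\in H$, $w\in H$ (i.e., the edge $\{u,v\}$ is oriented from $u$ to $v$ and the edge $\{v,w\}$ is oriented from $v$ to $w$). If $P>100\,m^{4/3}\log^2 n$, then $G$ contains at least $P/(100\log^2 n)$ $4$-cycles.
   Context: Graphs are simple, unweighted and undirected; $\deg(v)$ denotes the degree of node $v$ in $G$. A $2$-path is a path $u,v,w$ on three distinct nodes with edges $\{u,v\},\{v,w\}$; $v$ is its center. A $4$-cycle is a cycle on four distinct nodes. $\log$ denotes the logarithm (base 2). -}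

module Defs where

open import Level using (0ℓ)
open import Data.Nat using (ℕ; suc; _*_; _^_; _<_; _≤_; _<?_; NonZero)
open import Data.Nat.Properties
  using (*-identityʳ; *-cancelʳ-<; ^-monoˡ-≤; module ≤-Reasoning)
open import Data.Integer as ℤ using (+_; ∣_∣)
import Data.Integer.Properties as ℤ
open import Data.Rational.Unnormalised as ℚ using (ℚᵘ; mkℚᵘ; ↥_; ↧ₙ_)
import Data.Rational.Unnormalised.Properties as ℚ
open import Data.Fin using (Fin)
import Data.Fin as Fin
import Data.Fin.Properties as Fin
open import Data.List using (List; []; _∷_; length; filter; allFin; cartesianProduct)
open import Data.Product using (_×_; _,_; ∃-syntax)
open import Data.Sum using (_⊎_)
open import Function using (id)
open import Function.Bundles using (_⇔_; mk⇔)
open import Relation.Binary using (Rel; Symmetric; Irreflexive; Asymmetric)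
import Relation.Binary as Binary
open import Relation.Binary.PropositionalEquality using (_≡_; refl; sym; trans; cong; subst)
open import Relation.Nullary using (¬_; ¬?; _×-dec_)
open import Relation.Nullary.Decidable using (map)
open import Relation.Unary using (Pred; Decidable; _⊆_)
open import Data.Nat.Solver using (module +-*-Solver)

-- A nonnegative real x is represented by its upper cut { r ∈ ℚ | x < r }.

ℝ⁺ : Set₁
ℝ⁺ = Pred ℚᵘ 0ℓ

infix  4 _<ᵣ_ _≤ᵣ_
infixl 7 _*ᵣ_ _/ᵣ_

-- For rational r ≥ 0.
fromℚ : ℚᵘ → ℝ⁺
fromℚ r s = r ℚ.< s

fromℕ : ℕ → ℝ⁺
fromℕ k = fromℚ (mkℚᵘ (+ k) 0)

_≤ᵣ_ : ℝ⁺ → ℝ⁺ → Set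
x ≤ᵣ y = y ⊆ x

-- x < y iff x < r ≤ y for some rational r.
_<ᵣ_ : ℝ⁺ → ℝ⁺ → Set
x <ᵣ y = ∃[ r ] x r × fromℚ r ≤ᵣ y

_*ᵣ_ : ℝ⁺ → ℝ⁺ → ℝ⁺
(x *ᵣ y) r = ∃[ s ] ∃[ t ] x s × y t × s ℚ.* t ℚ.≤ r

-- The quotient for y > 0: then x / y < r iff x < r * y.
_/ᵣ_ : ℝ⁺ → ℝ⁺ → ℝ⁺
(x /ᵣ y) r = ℚ.Positive r × x <ᵣ fromℚ r *ᵣ y

-- k ^ (a / b): for r = p / q > 0,  k ^ (a / b) < r  iff  k ^ a * q ^ b < p ^ b.
_^[_/_] : ℕ → ℕ → (b : ℕ) → .{{NonZero b}} → ℝ⁺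
(k ^[ a / b ]) r = ℚ.Positive r × k ^ a * (↧ₙ r) ^ b < ∣ ↥ r ∣ ^ b

-- For r = p / q > 0 and k ≥ 1,  log₂ k < r  iff  k ^ q < 2 ^ p.
-- At k = 0 this gives the junk value log₂ 0 = 0.
log₂ : ℕ → ℝ⁺
log₂ k r = ℚ.Positive r × k ^ (↧ₙ r) < 2 ^ ∣ ↥ r ∣

∛<⇔<^3 : ∀ m d → m < d ^ 3 ⇔ m ^[ 1 / 3 ] <ᵣ fromℕ d
∛<⇔<^3 m d = mk⇔ (to d) from
  where
  open +-*-Solver

  to : ∀ d → m < d ^ 3 → m ^[ 1 / 3 ] <ᵣ fromℕ d
  to (suc d) m<d³ = mkℚᵘ (+ suc d) 0 , (_ , subst (_< suc d ^ 3) eq m<d³) , id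
    where
    eq : m ≡ m ^ 1 * 1 ^ 3
    eq = sym (trans (*-identityʳ (m ^ 1)) (*-identityʳ m))

  cube-* : ∀ x y → (x * y) ^ 3 ≡ x ^ 3 * y ^ 3
  cube-* = solve 2 (λ x y → (x :* y) :^ 3 := x :^ 3 :* y :^ 3) refl

  from : m ^[ 1 / 3 ] <ᵣ fromℕ d → m < d ^ 3
  from (r@(mkℚᵘ (+ p) q) , (_ , mq³<p³) , r≤d) =
    *-cancelʳ-< (suc q ^ 3) m (d ^ 3) (begin-strict
      m * suc q ^ 3      ≡⟨ cong (_* suc q ^ 3) (*-identityʳ m) ⟨
      m ^ 1 * suc q ^ 3  <⟨ mq³<p³ ⟩
      p ^ 3              ≤⟨ ^-monoˡ-≤ 3 p≤dq ⟩
      (d * suc q) ^ 3    ≡⟨ cube-* d (suc q) ⟩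
      d ^ 3 * suc q ^ 3  ∎)
    where
    open ≤-Reasoning

    r≤d′ : r ℚ.≤ mkℚᵘ (+ d) 0
    r≤d′ = ℚ.≮⇒≥ (λ d<r → ℚ.<-irrefl ℚ.≃-refl (r≤d {r} d<r))

    p≤dq : p ≤ d * suc q
    p≤dq = ℤ.drop‿+≤+ (subst (ℤ._≤ + (d * suc q)) (ℤ.*-identityʳ (+ p))
             (subst (+ p ℤ.* + 1 ℤ.≤_) (sym (ℤ.pos-* d (suc q))) (ℚ.drop-*≤* r≤d′)))

record Graph (n : ℕ) : Set₁ where
  infix 4 _~_ _~?_
  field
    _~_      : Rel (Fin n) 0ℓ
    _~?_     : Binary.Decidable _~_
    ~-sym    : Symmetric _~_
    ~-irrefl : Irreflexive _≡_ _~_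

module _ {n : ℕ} where

  open import Data.List.Relation.Unary.Unique.DecPropositional (Fin._≟_ {n})
    using (Unique; unique?)

  pairs : List (Fin n × Fin n)
  pairs = cartesianProduct (allFin n) (allFin n)

  triples : List (Fin n × Fin n × Fin n)
  triples = cartesianProduct (allFin n) pairs

  quadruples : List (Fin n × Fin n × Fin n × Fin n)
  quadruples = cartesianProduct (allFin n) triples

  module _ (G : Graph n) where
    open Graph G

    deg : Fin n → ℕ
    deg v = length (filter (v ~?_) (allFin n))

    #edges : ℕ
    #edges = length (filter (λ (u , v) → u Fin.<? v ×-dec u ~? v) pairs)

    High : Pred (Fin n) 0ℓ
    High v = #edges ^[ 1 / 3 ] <ᵣ fromℕ (deg v)

    Low : Pred (Fin n) 0ℓ
    Low v = ¬ High v

    high? : Decidable High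
    high? v = map (∛<⇔<^3 #edges (deg v)) (#edges <? deg v ^ 3)

    low? : Decidable Low
    low? v = ¬? (high? v)

    IsFourCycle : Fin n × Fin n × Fin n × Fin n → Set
    IsFourCycle (a , b , c , d) =
      Unique (a ∷ b ∷ c ∷ d ∷ []) × a ~ b × b ~ c × c ~ d × d ~ a

    isFourCycle? : Decidable IsFourCycle
    isFourCycle? (a , b , c , d) =
      unique? (a ∷ b ∷ c ∷ d ∷ []) ×-dec a ~? b ×-dec b ~? c ×-dec c ~? d ×-dec d ~? a

    -- A 4-cycle subgraph has eight traversals (four starting points, two
    -- directions).  Exactly one of them starts at the least node and visits
    -- the smaller neighbour of that node first.
    Canonical : Fin n × Fin n × Fin n × Fin n → Set
    Canonical (a , b , c , d) = a Fin.< b × a Fin.< c × a Fin.< d × b Fin.< d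

    canonical? : Decidable Canonical
    canonical? (a , b , c , d) =
      a Fin.<? b ×-dec a Fin.<? c ×-dec a Fin.<? d ×-dec b Fin.<? d

    #fourCycles : ℕ
    #fourCycles = length (filter (λ t → isFourCycle? t ×-dec canonical? t) quadruples)

    -- Every edge gets exactly one direction, towards an endpoint of larger or
    -- equal degree; edges between nodes of equal degree are unconstrained.
    record Orientation : Set₁ where
      infix 4 _⟶_ _⟶?_
      field
        _⟶_     : Rel (Fin n) 0ℓ
        _⟶?_    : Binary.Decidable _⟶_
        ⟶⇒~     : ∀ {u v} → u ⟶ v → u ~ v
        ~⇒⟶     : ∀ {u v} → u ~ v → u ⟶ v ⊎ v ⟶ u
        ⟶-asym  : Asymmetric _⟶_
        ⟶⇒deg≤  : ∀ {u v} → u ⟶ v → deg u ≤ deg v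

    module _ (O : Orientation) where
      open Orientation O

      IsLHHPath : Fin n × Fin n × Fin n → Set
      IsLHHPath (u , v , w) =
        Unique (u ∷ v ∷ w ∷ []) × u ⟶ v × v ⟶ w × Low u × High v × High w

      isLHHPath? : Decidable IsLHHPath
      isLHHPath? (u , v , w) =
        unique? (u ∷ v ∷ w ∷ []) ×-dec u ⟶? v ×-dec v ⟶? w
          ×-dec low? u ×-dec high? v ×-dec high? w

      #LHHPaths : ℕ
      #LHHPaths = length (filter isLHHPath? triples)

{-# OPTIONS --safe #-}

-- Let H_i be the subgraph induced by the high nodes of degree at least 2^i, with
-- N nodes and F ordered adjacent pairs.  Since deg v is at most the sum of the
-- powers 2^i ≤ deg v, and v ⟶ w puts w in every H_i containing v, P is at most
-- the sum of the products 2^i F over i < 2 ⌊log₂ n⌋.  Two applications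
-- of Cauchy–Schwarz bound F⁴ / N⁴ by the number of closed walks of length 4 in
-- H_i, and such a walk is a 4-cycle unless two opposite nodes coincide, which is
-- negligible when F² > 4 N³.  With N 2^i ≤ 2m and N m^(1/3) ≤ 2m this gives
-- (2^i F)³ ≤ 256 m⁴ or 2^i F ≤ #fourCycles.  If the second alternative holds for
-- the largest of these products, we are done; the first contradicts the lower
-- bound on P.
module Submission where

open import Defs
open import Level using (Level; 0ℓ)
import Data.Integer as ℤ
import Data.Integer.Properties as ℤ
open import Data.Fin using (Fin)
import Data.Fin as Fin
import Data.Fin.Properties as Fin
open import Data.List
  using (List; []; _∷_; _++_; map; length; filter; allFin; cartesianProduct; downFrom)
open import Data.List.Membership.Propositional.Properties using (∈-allFin)
open import Data.List.Properties using (length-tabulate; length-downFrom; filter-notAll)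
open import Data.List.Relation.Unary.All using (All; []; _∷_)
open import Data.List.Relation.Unary.AllPairs using ([]; _∷_)
import Data.List.Relation.Unary.Any as Any
open import Data.List.Relation.Unary.Unique.Propositional using (Unique)
open import Data.List.Relation.Unary.Unique.Propositional.Properties using (allFin⁺)
open import Data.Nat
open import Data.Nat.Properties
open import Data.Nat.Solver using (module +-*-Solver)
open import Data.Nat.Tactic.RingSolver using (solve-∀)
open import Data.Product using (_×_; _,_; ∃-syntax; proj₁; proj₂)
open import Data.Rational.Unnormalised as ℚ using (ℚᵘ; mkℚᵘ)
import Data.Rational.Unnormalised.Properties as ℚ
open import Data.Sum using (_⊎_; inj₁; inj₂; [_,_]′)
open import Function using (_∘_; const; id)
open import Function.Bundles using (Equivalence)
open import Relation.Binary using (tri<; tri≈; tri>)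
open import Relation.Binary.PropositionalEquality hiding ([_])
open import Relation.Nullary using (Dec; yes; no; ¬_; _×-dec_; _⊎-dec_; contradiction)
open import Relation.Unary using (Pred; Decidable)

private variable
  a p q r : Level
  A B : Set a
  P : Set p
  Q : Set q
  R : Set r

-- Elementary inequalities for squares.

square : ℕ → ℕ
square x = x * x

square-cancel-≤ : ∀ {x y} → square x ≤ square y → x ≤ y
square-cancel-≤ x²≤y² = ≮⇒≥ λ y<x → <⇒≱ (*-mono-< y<x y<x) x²≤y²

-- The two sides differ by the square of the distance between `x` and `y`; ordering them first
-- avoids truncated subtraction.
4xy≤[x+y]² : ∀ x y → 4 * (x * y) ≤ square (x + y)
4xy≤[x+y]² x y with ≤-total x y
... | inj₁ x≤y with k , refl ← m≤n⇒∃[o]m+o≡n x≤y =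
  ≤-trans (m≤m+n _ (square k)) (≤-reflexive (expand x k))
  where
  expand : ∀ x k → 4 * (x * (x + k)) + k * k ≡ (x + (x + k)) * (x + (x + k))
  expand = solve-∀
... | inj₂ y≤x with k , refl ← m≤n⇒∃[o]m+o≡n y≤x =
  ≤-trans (m≤m+n _ (square k)) (≤-reflexive (expand y k))
  where
  expand : ∀ y k → 4 * ((y + k) * y) + k * k ≡ ((y + k) + y) * ((y + k) + y)
  expand = solve-∀

-- Any `z` up to the geometric mean is allowed, so no square root occurs. This is the form needed
-- for the cross terms of Cauchy-Schwarz.
am-gm : ∀ z x y → square z ≤ x * y → 2 * z ≤ x + y
am-gm z x y z²≤xy = square-cancel-≤ (begin
  square (2 * z)  ≡⟨ double z ⟩
  4 * square z    ≤⟨ *-monoʳ-≤ 4 z²≤xy ⟩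
  4 * (x * y)     ≤⟨ 4xy≤[x+y]² x y ⟩
  square (x + y)  ∎)
  where
  open ≤-Reasoning
  double : ∀ z → (2 * z) * (2 * z) ≡ 4 * (z * z)
  double = solve-∀

-- Finite sums and the Cauchy-Schwarz inequality.

∑ : List A → (A → ℕ) → ℕ
∑ []       f = 0
∑ (x ∷ xs) f = f x + ∑ xs f

∑-mono : ∀ (xs : List A) {f g : A → ℕ} → (∀ x → f x ≤ g x) → ∑ xs f ≤ ∑ xs g
∑-mono []       f≤g = z≤n
∑-mono (x ∷ xs) f≤g = +-mono-≤ (f≤g x) (∑-mono xs f≤g)

∑-cong : ∀ (xs : List A) {f g : A → ℕ} → (∀ x → f x ≡ g x) → ∑ xs f ≡ ∑ xs g
∑-cong []       f≡g = refl
∑-cong (x ∷ xs) f≡g = cong₂ _+_ (f≡g x) (∑-cong xs f≡g)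

∑-0 : ∀ (xs : List A) → ∑ xs (const 0) ≡ 0
∑-0 []       = refl
∑-0 (x ∷ xs) = ∑-0 xs

∑-+ : ∀ (xs : List A) (f g : A → ℕ) → ∑ xs (λ x → f x + g x) ≡ ∑ xs f + ∑ xs g
∑-+ []       f g = refl
∑-+ (x ∷ xs) f g = trans (cong (f x + g x +_) (∑-+ xs f g)) (interchange (f x) (g x) _ _)
  where
  interchange : ∀ x y z w → x + y + (z + w) ≡ x + z + (y + w)
  interchange = solve-∀

∑-*ˡ : ∀ (xs : List A) c (f : A → ℕ) → ∑ xs (λ x → c * f x) ≡ c * ∑ xs f
∑-*ˡ []       c f = sym (*-zeroʳ c)
∑-*ˡ (x ∷ xs) c f = trans (cong (c * f x +_) (∑-*ˡ xs c f)) (sym (*-distribˡ-+ c (f x) _))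

∑-*ʳ : ∀ (xs : List A) c (f : A → ℕ) → ∑ xs (λ x → f x * c) ≡ ∑ xs f * c
∑-*ʳ xs c f = trans (∑-cong xs λ x → *-comm (f x) c) (trans (∑-*ˡ xs c f) (*-comm c _))

∑-* : ∀ (xs : List A) (ys : List B) (f : A → ℕ) (g : B → ℕ) →
      ∑ xs (λ x → ∑ ys λ y → f x * g y) ≡ ∑ xs f * ∑ ys g
∑-* xs ys f g = trans (∑-cong xs λ x → ∑-*ˡ ys (f x) g) (∑-*ʳ xs (∑ ys g) f)

∑-swap : ∀ (xs : List A) (ys : List B) (f : A → B → ℕ) →
         ∑ xs (λ x → ∑ ys λ y → f x y) ≡ ∑ ys (λ y → ∑ xs λ x → f x y)
∑-swap []       ys f = sym (∑-0 ys)
∑-swap (x ∷ xs) ys f =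
  trans (cong (∑ ys (f x) +_) (∑-swap xs ys f)) (sym (∑-+ ys (f x) _))

∑-++ : ∀ (xs ys : List A) (f : A → ℕ) → ∑ (xs ++ ys) f ≡ ∑ xs f + ∑ ys f
∑-++ []       ys f = refl
∑-++ (x ∷ xs) ys f = trans (cong (f x +_) (∑-++ xs ys f)) (sym (+-assoc (f x) _ _))

∑-map : ∀ (h : A → B) xs (f : B → ℕ) → ∑ (map h xs) f ≡ ∑ xs (f ∘ h)
∑-map h []       f = refl
∑-map h (x ∷ xs) f = cong (f (h x) +_) (∑-map h xs f)

∑-cartesianProduct : ∀ (xs : List A) (ys : List B) (f : A × B → ℕ) →
  ∑ (cartesianProduct xs ys) f ≡ ∑ xs λ x → ∑ ys λ y → f (x , y)
∑-cartesianProduct []       ys f = refl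
∑-cartesianProduct (x ∷ xs) ys f =
  trans (∑-++ (map (x ,_) ys) _ f)
    (cong₂ _+_ (∑-map (x ,_) ys f) (∑-cartesianProduct xs ys f))

-- The pointwise hypothesis replaces square roots of `g` and `h`. By induction the square of
-- `f x * F` is at most the product of `g x * H` and `h x * G`, so `am-gm` bounds the cross term.
cauchy-schwarz : ∀ (xs : List A) (f g h : A → ℕ) →
  (∀ x → square (f x) ≤ g x * h x) → square (∑ xs f) ≤ ∑ xs g * ∑ xs h
cauchy-schwarz []       f g h f²≤gh = z≤n
cauchy-schwarz (x ∷ xs) f g h f²≤gh = begin
  square (f x + F)                                      ≡⟨ expand (f x) F ⟩
  square (f x) + 2 * (f x * F) + square F
    ≤⟨ +-mono-≤ (+-mono-≤ (f²≤gh x) cross) F²≤GH ⟩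
  g x * h x + (g x * H + h x * G) + G * H               ≡⟨ factor (g x) (h x) G H ⟩
  (g x + G) * (h x + H)                                 ∎
  where
  open ≤-Reasoning
  F = ∑ xs f
  G = ∑ xs g
  H = ∑ xs h
  F²≤GH = cauchy-schwarz xs f g h f²≤gh
  expand : ∀ x y → (x + y) * (x + y) ≡ x * x + 2 * (x * y) + y * y
  expand = solve-∀
  factor : ∀ g h G H → g * h + (g * H + h * G) + G * H ≡ (g + G) * (h + H)
  factor = solve-∀
  regroup : ∀ x y z w → (x * y) * (z * w) ≡ (x * w) * (y * z)
  regroup = solve-∀
  cross : 2 * (f x * F) ≤ g x * H + h x * G
  cross = am-gm (f x * F) (g x * H) (h x * G) (begin
    square (f x * F)         ≡⟨ [m*n]*[o*p]≡[m*o]*[n*p] (f x) F (f x) F ⟩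
    square (f x) * square F  ≤⟨ *-mono-≤ (f²≤gh x) F²≤GH ⟩
    (g x * h x) * (G * H)    ≡⟨ regroup (g x) (h x) G H ⟩
    (g x * H) * (h x * G)    ∎)

-- `y` is the largest summand, or 0 for the empty list; hence `Q` is inherited.
∑-≤-length-* : ∀ {Q : Pred ℕ q} (xs : List A) (f : A → ℕ) → Q 0 → (∀ x → Q (f x)) →
  ∃[ y ] Q y × ∑ xs f ≤ length xs * y
∑-≤-length-* []       f Q0 Qf = 0 , Q0 , z≤n
∑-≤-length-* (x ∷ xs) f Q0 Qf with ∑-≤-length-* xs f Q0 Qf
... | y , Qy , ∑≤ with ≤-total (f x) y
...   | inj₁ fx≤y = y , Qy , +-mono-≤ fx≤y ∑≤
...   | inj₂ y≤fx =
  f x , Qf x , +-monoʳ-≤ (f x) (≤-trans ∑≤ (*-monoʳ-≤ (length xs) y≤fx))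

-- Indicators, integer thresholds and dyadic sums.

⟦_⟧ : Dec P → ℕ
⟦ yes _ ⟧ = 1
⟦ no  _ ⟧ = 0

⟦⟧-≤-⊎ : (p? : Dec P) (q? : Dec Q) (r? : Dec R) → (P → Q ⊎ R) → ⟦ p? ⟧ ≤ ⟦ q? ⟧ + ⟦ r? ⟧
⟦⟧-≤-⊎ (no _)  _       _       _ = z≤n
⟦⟧-≤-⊎ (yes _) (yes _) _       _ = s≤s z≤n
⟦⟧-≤-⊎ (yes _) (no _)  (yes _) _ = s≤s z≤n
⟦⟧-≤-⊎ (yes p) (no ¬q) (no ¬r) f with f p
... | inj₁ q = contradiction q ¬q
... | inj₂ r = contradiction r ¬r

⟦⟧-mono : (p? : Dec P) (q? : Dec Q) → (P → Q) → ⟦ p? ⟧ ≤ ⟦ q? ⟧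
⟦⟧-mono (no _)  _       _ = z≤n
⟦⟧-mono (yes _) (yes _) _ = s≤s z≤n
⟦⟧-mono (yes p) (no ¬q) f = contradiction (f p) ¬q

⟦⟧-×-dec : (p? : Dec P) (q? : Dec Q) → ⟦ p? ×-dec q? ⟧ ≡ ⟦ p? ⟧ * ⟦ q? ⟧
⟦⟧-×-dec (no _)  _       = refl
⟦⟧-×-dec (yes _) (yes _) = refl
⟦⟧-×-dec (yes _) (no _)  = refl

-- Exhibits the indicator of a support as a factor; Cauchy-Schwarz then yields the size of that
-- support.
⟦⟧-absorb : (p? : Dec P) (q? : Dec Q) → (P → Q) → ⟦ p? ⟧ ≡ ⟦ q? ⟧ * ⟦ p? ⟧
⟦⟧-absorb (no _)  q?      _ = sym (*-zeroʳ ⟦ q? ⟧)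
⟦⟧-absorb (yes _) (yes _) _ = refl
⟦⟧-absorb (yes p) (no ¬q) f = contradiction (f p) ¬q

length-filter : ∀ {P : Pred A p} (P? : Decidable P) xs → length (filter P? xs) ≡ ∑ xs (⟦_⟧ ∘ P?)
length-filter P? [] = refl
length-filter P? (x ∷ xs) with P? x
... | yes _ = cong suc (length-filter P? xs)
... | no  _ = length-filter P? xs

∑-⟦≟⟧≤1 : ∀ {n} (x : Fin n) → ∑ (allFin n) (λ y → ⟦ x Fin.≟ y ⟧) ≤ 1
∑-⟦≟⟧≤1 {n} x = go (allFin⁺ n)
  where
  all-≢⇒0 : ∀ {ys} → All (λ y → ¬ x ≡ y) ys → ∑ ys (λ y → ⟦ x Fin.≟ y ⟧) ≡ 0
  all-≢⇒0 [] = refl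
  all-≢⇒0 {y ∷ _} (x≢y ∷ x≢ys) with x Fin.≟ y
  ... | yes x≡y = contradiction x≡y x≢y
  ... | no  _   = all-≢⇒0 x≢ys
  go : ∀ {ys} → Unique ys → ∑ ys (λ y → ⟦ x Fin.≟ y ⟧) ≤ 1
  go [] = z≤n
  go {y ∷ _} (y≢ys ∷ uniq) with x Fin.≟ y
  ... | yes refl = s≤s (≤-reflexive (all-≢⇒0 y≢ys))
  ... | no  _    = go uniq

-- For `suc x` the index stays at `k` or moves to `suc k`, since strict growth gives
-- `x < f (suc k)`. This supplies integer versions of the cube root of m and of log₂ n.
least-≥ : ∀ (f : ℕ → ℕ) → (∀ {i j} → i < j → f i < f j) →
  ∀ x → ∃[ k ] x ≤ f k × (∀ j → j < k → f j < x)
least-≥ f f-mono zero    = 0 , z≤n , λ _ ()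
least-≥ f f-mono (suc x) with least-≥ f f-mono x
... | k , x≤fk , below with suc x ≤? f k
...   | yes x<fk = k , x<fk , λ j j<k → m<n⇒m<1+n (below j j<k)
...   | no  x≮fk = suc k , ≤-<-trans x≤fk (f-mono (n<1+n k)) ,
  λ j j<1+k → ≤-<-trans (fj≤fk (s≤s⁻¹ j<1+k)) (≰⇒> x≮fk)
  where
  fj≤fk : ∀ {j} → j ≤ k → f j ≤ f k
  fj≤fk j≤k with m≤n⇒m<n∨m≡n j≤k
  ... | inj₁ j<k  = <⇒≤ (f-mono j<k)
  ... | inj₂ refl = ≤-refl

-- If 2^j is the largest power of 2 up to a positive `d`, the sum is 2^(j+1) - 1, hence at least
-- `d`.
≤-∑-powers : ∀ k d → d < 2 ^ k → d ≤ ∑ (downFrom k) λ i → ⟦ 2 ^ i ≤? d ⟧ * 2 ^ i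
≤-∑-powers k d d<2^k with go k
  where
  S : ℕ → ℕ
  S k = ∑ (downFrom k) λ i → ⟦ 2 ^ i ≤? d ⟧ * 2 ^ i
  -- As long as no power has been skipped the sum is 2^k - 1; the first skipped power exceeds `d`,
  -- so the sum has then reached `d`.
  go : ∀ k → d ≤ S k ⊎ 2 ^ k ≤ suc (S k)
  go zero = inj₂ ≤-refl
  go (suc k) with 2 ^ k ≤? d | go k
  ... | yes _ | inj₁ d≤S  = inj₁ (≤-trans d≤S (m≤n+m _ _))
  ... | yes _ | inj₂ 2^k≤ = inj₂ (begin
    2 * 2 ^ k                 ≡⟨ double (2 ^ k) ⟩
    1 * 2 ^ k + 2 ^ k         ≤⟨ +-monoʳ-≤ (1 * 2 ^ k) 2^k≤ ⟩
    1 * 2 ^ k + suc (S k)     ≡⟨ +-suc _ _ ⟩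
    suc (1 * 2 ^ k + S k)     ∎)
    where
    open ≤-Reasoning
    double : ∀ x → 2 * x ≡ 1 * x + x
    double = solve-∀
  ... | no 2^k≰d | inj₁ d≤S  = inj₁ d≤S
  ... | no 2^k≰d | inj₂ 2^k≤ = inj₁ (s≤s⁻¹ (≤-trans (≰⇒> 2^k≰d) 2^k≤))
... | inj₁ d≤S   = d≤S
... | inj₂ 2^k≤S = s≤s⁻¹ (≤-trans d<2^k 2^k≤S)

-- Each `x` with `P` is charged to `x` or to `σ x`; since `σ` preserves sums, either kind of charge
-- totals at most the count of `Q`. One use breaks one symmetry of order 2.
∑-⟦⟧≤2* : ∀ {P : Pred A p} {Q : Pred A q} (xs : List A) (σ : A → A) →
  (∀ (f : A → ℕ) → ∑ xs (f ∘ σ) ≡ ∑ xs f) →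
  (P? : Decidable P) (Q? : Decidable Q) → (∀ {x} → P x → Q x ⊎ Q (σ x)) →
  ∑ xs (⟦_⟧ ∘ P?) ≤ 2 * ∑ xs (⟦_⟧ ∘ Q?)
∑-⟦⟧≤2* xs σ σ-inv P? Q? P⇒Q = begin
  ∑ xs (⟦_⟧ ∘ P?)
    ≤⟨ ∑-mono xs (λ x → ⟦⟧-≤-⊎ (P? x) (Q? x) (Q? (σ x)) P⇒Q) ⟩
  ∑ xs (λ x → ⟦ Q? x ⟧ + ⟦ Q? (σ x) ⟧)      ≡⟨ ∑-+ xs _ _ ⟩
  ∑ xs (⟦_⟧ ∘ Q?) + ∑ xs (⟦_⟧ ∘ Q? ∘ σ)    ≡⟨ cong (∑ xs (⟦_⟧ ∘ Q?) +_) (σ-inv (⟦_⟧ ∘ Q?)) ⟩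
  ∑ xs (⟦_⟧ ∘ Q?) + ∑ xs (⟦_⟧ ∘ Q?)        ≡⟨ cong (∑ xs (⟦_⟧ ∘ Q?) +_) (+-identityʳ _) ⟨
  2 * ∑ xs (⟦_⟧ ∘ Q?)                      ∎
  where open ≤-Reasoning

-- Iterated sums over nodes.

module FinSums (n : ℕ) where

  ∑ᵥ : (Fin n → ℕ) → ℕ
  ∑ᵥ = ∑ (allFin n)

  ∑ᵥ-mono : ∀ {f g : Fin n → ℕ} → (∀ x → f x ≤ g x) → ∑ᵥ f ≤ ∑ᵥ g
  ∑ᵥ-mono = ∑-mono (allFin n)

  ∑ᵥ-cong : ∀ {f g : Fin n → ℕ} → (∀ x → f x ≡ g x) → ∑ᵥ f ≡ ∑ᵥ g
  ∑ᵥ-cong = ∑-cong (allFin n)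

  ∑ᵥ-swap : ∀ (f : Fin n → Fin n → ℕ) →
            ∑ᵥ (λ x → ∑ᵥ λ y → f x y) ≡ ∑ᵥ (λ y → ∑ᵥ λ x → f x y)
  ∑ᵥ-swap = ∑-swap (allFin n) (allFin n)

  ∑ᵥ-reverse : ∀ (f : Fin n → Fin n → Fin n → ℕ) →
    ∑ᵥ (λ x → ∑ᵥ λ y → ∑ᵥ λ z → f z y x) ≡ ∑ᵥ (λ x → ∑ᵥ λ y → ∑ᵥ λ z → f x y z)
  ∑ᵥ-reverse f = begin
    ∑ᵥ (λ x → ∑ᵥ λ y → ∑ᵥ λ z → f z y x)  ≡⟨ ∑ᵥ-cong (λ x → ∑ᵥ-swap _) ⟩
    ∑ᵥ (λ x → ∑ᵥ λ z → ∑ᵥ λ y → f z y x)  ≡⟨ ∑ᵥ-swap _ ⟩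
    ∑ᵥ (λ z → ∑ᵥ λ x → ∑ᵥ λ y → f z y x)  ≡⟨ ∑ᵥ-cong (λ x → ∑ᵥ-swap _) ⟩
    ∑ᵥ (λ z → ∑ᵥ λ y → ∑ᵥ λ x → f z y x)  ∎
    where open ≡-Reasoning

  ∑-pairs : ∀ (f : Fin n × Fin n → ℕ) → ∑ pairs f ≡ ∑ᵥ λ x → ∑ᵥ λ y → f (x , y)
  ∑-pairs = ∑-cartesianProduct (allFin n) (allFin n)

  ∑-triples : ∀ (f : Fin n × Fin n × Fin n → ℕ) →
    ∑ triples f ≡ ∑ᵥ λ x → ∑ᵥ λ y → ∑ᵥ λ z → f (x , y , z)
  ∑-triples f = trans (∑-cartesianProduct (allFin n) pairs f) (∑ᵥ-cong λ x → ∑-pairs _)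

  ∑-quadruples : ∀ (f : Fin n × Fin n × Fin n × Fin n → ℕ) →
    ∑ quadruples f ≡ ∑ᵥ λ x → ∑ᵥ λ y → ∑ᵥ λ z → ∑ᵥ λ w → f (x , y , z , w)
  ∑-quadruples f =
    trans (∑-cartesianProduct (allFin n) triples f) (∑ᵥ-cong λ x → ∑-triples _)

-- Symmetries of 4-cycles.

module _ {n : ℕ} (G : Graph n) where
  open Graph G
  open FinSums n

  private
    Quad : Set
    Quad = Fin n × Fin n × Fin n × Fin n

    rotate reverse : Quad → Quad
    rotate (a , b , c , d) = b , c , d , a
    reverse (a , b , c , d) = d , c , b , a

    rotate-cycle : ∀ {t} → IsFourCycle G t → IsFourCycle G (rotate t)
    rotate-cycle
      ( (a≢b ∷ a≢c ∷ a≢d ∷ []) ∷ (b≢c ∷ b≢d ∷ []) ∷ (c≢d ∷ []) ∷ [] ∷ []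
      , a~b , b~c , c~d , d~a ) =
      (b≢c ∷ b≢d ∷ ≢-sym a≢b ∷ []) ∷ (c≢d ∷ ≢-sym a≢c ∷ []) ∷ (≢-sym a≢d ∷ []) ∷ [] ∷ []
      , b~c , c~d , d~a , a~b

    reverse-cycle : ∀ {t} → IsFourCycle G t → IsFourCycle G (reverse t)
    reverse-cycle
      ( (a≢b ∷ a≢c ∷ a≢d ∷ []) ∷ (b≢c ∷ b≢d ∷ []) ∷ (c≢d ∷ []) ∷ [] ∷ []
      , a~b , b~c , c~d , d~a ) =
      (≢-sym c≢d ∷ ≢-sym b≢d ∷ ≢-sym a≢d ∷ []) ∷ (≢-sym b≢c ∷ ≢-sym a≢c ∷ [])
        ∷ (≢-sym a≢b ∷ []) ∷ [] ∷ []
      , ~-sym c~d , ~-sym b~c , ~-sym a~b , ~-sym d~a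

    -- Reflections of the cycle: `σ₁` and `σ₂` each exchange one pair of opposite nodes, `σ₃` flips
    -- two opposite edges.
    σ₁ σ₂ σ₃ : Quad → Quad
    σ₁ (a , b , c , d) = a , d , c , b
    σ₂ (a , b , c , d) = c , b , a , d
    σ₃ (a , b , c , d) = b , a , d , c

    ∑-σ₁ : ∀ f → ∑ quadruples (f ∘ σ₁) ≡ ∑ quadruples f
    ∑-σ₁ f = trans (∑-quadruples (f ∘ σ₁))
      (trans (∑ᵥ-cong λ a → ∑ᵥ-reverse λ b c d → f (a , b , c , d)) (sym (∑-quadruples f)))

    ∑-σ₂ : ∀ f → ∑ quadruples (f ∘ σ₂) ≡ ∑ quadruples f
    ∑-σ₂ f = trans (∑-quadruples (f ∘ σ₂))
      (trans (∑ᵥ-reverse λ a b c → ∑ᵥ λ d → f (a , b , c , d)) (sym (∑-quadruples f)))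

    ∑-σ₃ : ∀ f → ∑ quadruples (f ∘ σ₃) ≡ ∑ quadruples f
    ∑-σ₃ f = trans (∑-quadruples (f ∘ σ₃))
      (trans (trans (∑ᵥ-swap _) (∑ᵥ-cong λ a → ∑ᵥ-cong λ b → ∑ᵥ-swap _))
        (sym (∑-quadruples f)))

  -- Up to the eight symmetries one may assume first b < d, then a < c, then a < b.
  ∑-fourCycles≤8* : ∑ quadruples (⟦_⟧ ∘ isFourCycle? G) ≤ 8 * #fourCycles G
  ∑-fourCycles≤8* = begin
    ∑ quadruples (⟦_⟧ ∘ isFourCycle? G)
      ≤⟨ ∑-⟦⟧≤2* quadruples σ₁ ∑-σ₁ (isFourCycle? G) b<d? step₁ ⟩
    2 * ∑ quadruples (⟦_⟧ ∘ b<d?)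
      ≤⟨ *-monoʳ-≤ 2 (∑-⟦⟧≤2* quadruples σ₂ ∑-σ₂ b<d? a<c? step₂) ⟩
    2 * (2 * ∑ quadruples (⟦_⟧ ∘ a<c?))
      ≤⟨ *-monoʳ-≤ 2 (*-monoʳ-≤ 2 (∑-⟦⟧≤2* quadruples σ₃ ∑-σ₃ a<c? canon? step₃)) ⟩
    2 * (2 * (2 * ∑ quadruples (⟦_⟧ ∘ canon?)))
      ≡⟨ 2*2*2* (∑ quadruples (⟦_⟧ ∘ canon?)) ⟩
    8 * ∑ quadruples (⟦_⟧ ∘ canon?)
      ≡⟨ cong (8 *_) (length-filter canon? quadruples) ⟨
    8 * #fourCycles G ∎
    where
    open ≤-Reasoning

    2*2*2* : ∀ x → 2 * (2 * (2 * x)) ≡ 8 * x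
    2*2*2* = solve-∀

    b<d? : Decidable (λ t@(a , b , c , d) → IsFourCycle G t × b Fin.< d)
    b<d? t@(a , b , c , d) = isFourCycle? G t ×-dec b Fin.<? d

    a<c? : Decidable (λ t@(a , b , c , d) → IsFourCycle G t × b Fin.< d × a Fin.< c)
    a<c? t@(a , b , c , d) = isFourCycle? G t ×-dec b Fin.<? d ×-dec a Fin.<? c

    canon? : Decidable (λ t → IsFourCycle G t × Canonical G t)
    canon? t = isFourCycle? G t ×-dec canonical? G t

    step₁ : ∀ {t@(a , b , c , d) : Quad} → IsFourCycle G t →
      (IsFourCycle G t × b Fin.< d) ⊎ (IsFourCycle G (σ₁ t) × d Fin.< b)
    step₁ {a , b , c , d} cyc@(_ ∷ (_ ∷ b≢d ∷ []) ∷ _ , _) with Fin.<-cmp b d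
    ... | tri< b<d _ _ = inj₁ (cyc , b<d)
    ... | tri≈ _ b≡d _ = contradiction b≡d b≢d
    ... | tri> _ _ d<b = inj₂
      (rotate-cycle (rotate-cycle (rotate-cycle (reverse-cycle cyc))) , d<b)

    step₂ : ∀ {t@(a , b , c , d) : Quad} → IsFourCycle G t × b Fin.< d →
      (IsFourCycle G t × b Fin.< d × a Fin.< c)
        ⊎ (IsFourCycle G (σ₂ t) × b Fin.< d × c Fin.< a)
    step₂ {a , b , c , d} (cyc@((_ ∷ a≢c ∷ _) ∷ _ , _) , b<d) with Fin.<-cmp a c
    ... | tri< a<c _ _ = inj₁ (cyc , b<d , a<c)
    ... | tri≈ _ a≡c _ = contradiction a≡c a≢c
    ... | tri> _ _ c<a = inj₂ (rotate-cycle (reverse-cycle cyc) , b<d , c<a)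

    -- Given `b < d` and `a < c`, the smaller of `a` and `b` is the least node, and `σ₃` exchanges
    -- these two.
    step₃ : ∀ {t@(a , b , c , d) : Quad} → IsFourCycle G t × b Fin.< d × a Fin.< c →
      (IsFourCycle G t × Canonical G t) ⊎ (IsFourCycle G (σ₃ t) × Canonical G (σ₃ t))
    step₃ {a , b , c , d} (cyc@((a≢b ∷ _) ∷ _ , _) , b<d , a<c) with Fin.<-cmp a b
    ... | tri< a<b _ _ = inj₁ (cyc , a<b , a<c , <-trans a<b b<d , b<d)
    ... | tri≈ _ a≡b _ = contradiction a≡b a≢b
    ... | tri> _ _ b<a = inj₂
      (rotate-cycle (rotate-cycle (reverse-cycle cyc)) , b<a , b<d , <-trans b<a a<c , a<c)

  -- Degrees and the handshake bound.

  deg≡∑ : ∀ v → deg G v ≡ ∑ᵥ λ u → ⟦ v ~? u ⟧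
  deg≡∑ v = length-filter (v ~?_) (allFin n)

  -- Irreflexivity keeps `v` out of its own neighbourhood. Strictness makes `n ≤ 2 ^ k` enough for
  -- `≤-∑-powers`.
  deg<n : ∀ v → deg G v < n
  deg<n v = subst (deg G v <_) (length-tabulate id)
    (filter-notAll (v ~?_) (allFin n) (Any.map (λ { refl → ~-irrefl refl }) (∈-allFin v)))

  -- Of each ordered adjacent pair and its flip, one is listed by `#edges`.
  ∑-deg≤2* : ∑ᵥ (deg G) ≤ 2 * #edges G
  ∑-deg≤2* = begin
    ∑ᵥ (deg G)                                 ≡⟨ ∑ᵥ-cong deg≡∑ ⟩
    ∑ᵥ (λ u → ∑ᵥ λ v → ⟦ u ~? v ⟧)             ≡⟨ ∑-pairs _ ⟨
    ∑ pairs (λ (u , v) → ⟦ u ~? v ⟧)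
      ≤⟨ ∑-⟦⟧≤2* pairs (λ (u , v) → v , u) ∑-flip (λ (u , v) → u ~? v) edge? orient ⟩
    2 * ∑ pairs (⟦_⟧ ∘ edge?)                  ≡⟨ cong (2 *_) (length-filter edge? pairs) ⟨
    2 * #edges G                               ∎
    where
    open ≤-Reasoning
    edge? : Decidable (λ (u , v) → u Fin.< v × u ~ v)
    edge? (u , v) = u Fin.<? v ×-dec u ~? v
    ∑-flip : ∀ (f : Fin n × Fin n → ℕ) → ∑ pairs (λ (u , v) → f (v , u)) ≡ ∑ pairs f
    ∑-flip f = trans (∑-pairs _) (trans (∑ᵥ-swap _) (sym (∑-pairs f)))
    orient : ∀ {(u , v) : Fin n × Fin n} → u ~ v →
      (u Fin.< v × u ~ v) ⊎ (v Fin.< u × v ~ u)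
    orient {u , v} u~v with Fin.<-cmp u v
    ... | tri< u<v _ _ = inj₁ (u<v , u~v)
    ... | tri≈ _ u≡v _ = contradiction u~v (~-irrefl u≡v)
    ... | tri> _ _ v<u = inj₂ (v<u , ~-sym u~v)

  -- Walk counts in an induced subgraph.

  module InducedSubgraph {ℓ} {S : Pred (Fin n) ℓ} (S? : Decidable S) where

    Adj : Fin n → Fin n → Set ℓ
    Adj u v = u ~ v × S u × S v

    adj? : ∀ u v → Dec (Adj u v)
    adj? u v = u ~? v ×-dec S? u ×-dec S? v

    size : ℕ
    size = ∑ᵥ λ v → ⟦ S? v ⟧

    degree : Fin n → ℕ
    degree v = ∑ᵥ λ u → ⟦ adj? v u ⟧

    codegree : Fin n × Fin n → ℕ
    codegree (u , v) = ∑ᵥ λ w → ⟦ adj? w u ⟧ * ⟦ adj? w v ⟧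

    size-*-≤ : ∀ k → (∀ {v} → S v → k ≤ deg G v) → size * k ≤ 2 * #edges G
    size-*-≤ k k≤deg = begin
      size * k                  ≡⟨ ∑-*ʳ (allFin n) k _ ⟨
      ∑ᵥ (λ v → ⟦ S? v ⟧ * k)   ≤⟨ ∑ᵥ-mono bound ⟩
      ∑ᵥ (deg G)                ≤⟨ ∑-deg≤2* ⟩
      2 * #edges G              ∎
      where
      open ≤-Reasoning
      bound : ∀ v → ⟦ S? v ⟧ * k ≤ deg G v
      bound v with S? v
      ... | yes Sv = ≤-trans (≤-reflexive (*-identityˡ k)) (k≤deg Sv)
      ... | no  _  = z≤n

    private
      square-absorb : ∀ s f → f ≡ s * f → square f ≤ s * square f
      square-absorb s f f≡sf = ≤-reflexive (trans (cong (_* f) f≡sf) (*-assoc s f f))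

    -- First Cauchy-Schwarz: `degree` vanishes outside `S`, so the indicator of `S` contributes the
    -- factor `size`.
    ∑-degree²≤ : square (∑ᵥ degree) ≤ size * ∑ᵥ (square ∘ degree)
    ∑-degree²≤ = cauchy-schwarz (allFin n) degree (⟦_⟧ ∘ S?) (square ∘ degree)
      λ v → square-absorb ⟦ S? v ⟧ (degree v)
        (trans (∑ᵥ-cong λ u → ⟦⟧-absorb (adj? v u) (S? v) (proj₁ ∘ proj₂)) (∑-*ˡ (allFin n) ⟦ S? v ⟧ _))

    -- Walks of length 2, sorted by their ends on the left and by their centre on the right.
    ∑-codegree : ∑ pairs codegree ≡ ∑ᵥ (square ∘ degree)
    ∑-codegree = begin
      ∑ pairs codegree
        ≡⟨ ∑-swap (pairs {n}) (allFin n) _ ⟩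
      ∑ᵥ (λ w → ∑ pairs λ (u , v) → ⟦ adj? w u ⟧ * ⟦ adj? w v ⟧)
        ≡⟨ ∑ᵥ-cong (λ w → trans (∑-pairs _) (∑-* (allFin n) (allFin n) _ _)) ⟩
      ∑ᵥ (square ∘ degree) ∎
      where open ≡-Reasoning

    -- Second Cauchy-Schwarz, over the pairs of nodes of `S`, outside of which `codegree` vanishes.
    ∑-codegree²≤ : square (∑ pairs codegree) ≤ square size * ∑ pairs (square ∘ codegree)
    ∑-codegree²≤ = begin
      square (∑ pairs codegree)
        ≤⟨ cauchy-schwarz pairs codegree SS (square ∘ codegree)
             (λ t → square-absorb (SS t) (codegree t) (absorb t)) ⟩
      ∑ pairs SS * ∑ pairs (square ∘ codegree)
        ≡⟨ cong (_* ∑ pairs (square ∘ codegree)) (trans (∑-pairs SS) (∑-* (allFin n) (allFin n) _ _)) ⟩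
      square size * ∑ pairs (square ∘ codegree) ∎
      where
      open ≤-Reasoning
      SS : Fin n × Fin n → ℕ
      SS (u , v) = ⟦ S? u ⟧ * ⟦ S? v ⟧
      absorb : ∀ t → codegree t ≡ SS t * codegree t
      absorb (u , v) = trans
        (∑ᵥ-cong λ w → trans
          (cong₂ _*_ (⟦⟧-absorb (adj? w u) (S? u) (proj₂ ∘ proj₂))
                     (⟦⟧-absorb (adj? w v) (S? v) (proj₂ ∘ proj₂)))
          ([m*n]*[o*p]≡[m*o]*[n*p] ⟦ S? u ⟧ ⟦ adj? w u ⟧ ⟦ S? v ⟧ ⟦ adj? w v ⟧))
        (∑-*ˡ (allFin n) (⟦ S? u ⟧ * ⟦ S? v ⟧) _)

    -- A closed walk of length 4 is a 4-cycle unless two opposite nodes coincide.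
    ∑-codegree-square≤ :
      ∑ pairs (square ∘ codegree) ≤ 8 * #fourCycles G + 2 * ∑ᵥ (square ∘ degree)
    ∑-codegree-square≤ = begin
      ∑ pairs (square ∘ codegree)
        ≡⟨ ∑-cong (pairs {n}) (λ _ → trans (sym (∑-* (allFin n) (allFin n) _ _)) (sym (∑-pairs _))) ⟩
      ∑ pairs (λ (u , v) → ∑ pairs λ (w , x) →
        (⟦ adj? w u ⟧ * ⟦ adj? w v ⟧) * (⟦ adj? x u ⟧ * ⟦ adj? x v ⟧))
        ≤⟨ ∑-mono pairs (λ s → ∑-mono pairs λ t → walk≤ s t) ⟩
      ∑ pairs (λ s → ∑ pairs λ t → cycle s t + (degenerate s t + degenerate t s))
        ≡⟨ ∑∑-+ cycle _ ⟩
      ∑ pairs (λ s → ∑ pairs λ t → cycle s t)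
        + ∑ pairs (λ s → ∑ pairs λ t → degenerate s t + degenerate t s)
        ≡⟨ cong (∑ pairs (λ s → ∑ pairs λ t → cycle s t) +_) (∑∑-+ degenerate _) ⟩
      ∑ pairs (λ s → ∑ pairs λ t → cycle s t)
        + (∑ pairs (λ s → ∑ pairs λ t → degenerate s t)
           + ∑ pairs (λ s → ∑ pairs λ t → degenerate t s))
        ≤⟨ +-mono-≤ ∑-cycle≤ (+-mono-≤ ∑-degenerate≤
             (≤-trans (≤-reflexive (∑-swap (pairs {n}) (pairs {n}) _))
               (≤-trans ∑-degenerate≤ (≤-reflexive (sym (+-identityʳ _)))))) ⟩
      8 * #fourCycles G + 2 * ∑ᵥ (square ∘ degree) ∎
      where
      open ≤-Reasoning

      cycle degenerate : Fin n × Fin n → Fin n × Fin n → ℕ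
      -- `u`, `v` and `w`, `x` are the two pairs of opposite nodes, hence the alternating order.
      cycle (u , v) (w , x) = ⟦ isFourCycle? G (u , w , v , x) ⟧
      -- Walks with `u = v`; exchanging the two arguments covers `w = x`.
      degenerate (u , v) (w , x) = ⟦ u Fin.≟ v ×-dec adj? u w ×-dec adj? u x ⟧

      ∑∑-+ : ∀ (f g : Fin n × Fin n → Fin n × Fin n → ℕ) →
        ∑ pairs (λ s → ∑ pairs λ t → f s t + g s t)
          ≡ ∑ pairs (λ s → ∑ pairs λ t → f s t) + ∑ pairs (λ s → ∑ pairs λ t → g s t)
      ∑∑-+ f g = trans (∑-cong pairs λ s → ∑-+ pairs (f s) (g s)) (∑-+ (pairs {n}) _ _)

      adj-sym : ∀ {u v} → Adj u v → Adj v u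
      adj-sym (u~v , Su , Sv) = ~-sym u~v , Sv , Su

      adj⇒≢ : ∀ {u v} → Adj u v → u ≢ v
      adj⇒≢ (u~v , _) u≡v = ~-irrefl u≡v u~v

      walk≤ : ∀ (s@(u , v) t@(w , x) : Fin n × Fin n) →
        (⟦ adj? w u ⟧ * ⟦ adj? w v ⟧) * (⟦ adj? x u ⟧ * ⟦ adj? x v ⟧)
          ≤ cycle s t + (degenerate s t + degenerate t s)
      walk≤ (u , v) (w , x) = begin
        (⟦ adj? w u ⟧ * ⟦ adj? w v ⟧) * (⟦ adj? x u ⟧ * ⟦ adj? x v ⟧)
          ≡⟨ cong₂ _*_ (⟦⟧-×-dec (adj? w u) (adj? w v)) (⟦⟧-×-dec (adj? x u) (adj? x v)) ⟨
        ⟦ wu-wv? ⟧ * ⟦ xu-xv? ⟧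
          ≡⟨ ⟦⟧-×-dec wu-wv? xu-xv? ⟨
        ⟦ wu-wv? ×-dec xu-xv? ⟧
          ≤⟨ ⟦⟧-≤-⊎ (wu-wv? ×-dec xu-xv?) (isFourCycle? G (u , w , v , x)) (uv? ⊎-dec wx?) split ⟩
        cycle (u , v) (w , x) + ⟦ uv? ⊎-dec wx? ⟧
          ≤⟨ +-monoʳ-≤ _ (⟦⟧-≤-⊎ (uv? ⊎-dec wx?) uv? wx? id) ⟩
        cycle (u , v) (w , x) + (degenerate (u , v) (w , x) + degenerate (w , x) (u , v)) ∎
        where
        wu-wv? = adj? w u ×-dec adj? w v
        xu-xv? = adj? x u ×-dec adj? x v
        uv? = u Fin.≟ v ×-dec adj? u w ×-dec adj? u x
        wx? = w Fin.≟ x ×-dec adj? w u ×-dec adj? w v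
        split : (Adj w u × Adj w v) × (Adj x u × Adj x v) →
          IsFourCycle G (u , w , v , x)
            ⊎ (u ≡ v × Adj u w × Adj u x) ⊎ (w ≡ x × Adj w u × Adj w v)
        split ((wu , wv) , (xu , xv)) with u Fin.≟ v | w Fin.≟ x
        ... | yes u≡v | _       = inj₂ (inj₁ (u≡v , adj-sym wu , adj-sym xu))
        ... | no  _   | yes w≡x = inj₂ (inj₂ (w≡x , wu , wv))
        ... | no  u≢v | no  w≢x = inj₁
          ( (≢-sym (adj⇒≢ wu) ∷ u≢v ∷ ≢-sym (adj⇒≢ xu) ∷ [])
              ∷ (adj⇒≢ wv ∷ w≢x ∷ []) ∷ (≢-sym (adj⇒≢ xv) ∷ []) ∷ [] ∷ []
          , ~-sym (proj₁ wu) , proj₁ wv , ~-sym (proj₁ xv) , proj₁ xu )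

      ∑-cycle≤ : ∑ pairs (λ s → ∑ pairs λ t → cycle s t) ≤ 8 * #fourCycles G
      ∑-cycle≤ = begin
        ∑ pairs (λ s → ∑ pairs λ t → cycle s t)
          ≡⟨ ∑-pairs _ ⟩
        ∑ᵥ (λ u → ∑ᵥ λ v → ∑ pairs λ t → cycle (u , v) t)
          ≡⟨ ∑ᵥ-cong (λ u → ∑ᵥ-cong λ v → ∑-pairs _) ⟩
        ∑ᵥ (λ u → ∑ᵥ λ v → ∑ᵥ λ w → ∑ᵥ λ x → cycle (u , v) (w , x))
          ≡⟨ ∑ᵥ-cong (λ u → ∑ᵥ-swap _) ⟩
        ∑ᵥ (λ u → ∑ᵥ λ w → ∑ᵥ λ v → ∑ᵥ λ x → cycle (u , v) (w , x))
          ≡⟨ ∑-quadruples _ ⟨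
        ∑ quadruples (⟦_⟧ ∘ isFourCycle? G)
          ≤⟨ ∑-fourCycles≤8* ⟩
        8 * #fourCycles G ∎

      -- With `u = v`, the nodes `w` and `x` range independently over the neighbours of `u`.
      ∑-degenerate≤ :
        ∑ pairs (λ s → ∑ pairs λ t → degenerate s t) ≤ ∑ᵥ (square ∘ degree)
      ∑-degenerate≤ = begin
        ∑ pairs (λ s → ∑ pairs λ t → degenerate s t)
          ≡⟨ ∑-cong pairs factor ⟩
        ∑ pairs (λ (u , v) → ⟦ u Fin.≟ v ⟧ * square (degree u))
          ≡⟨ ∑-pairs _ ⟩
        ∑ᵥ (λ u → ∑ᵥ λ v → ⟦ u Fin.≟ v ⟧ * square (degree u))
          ≡⟨ ∑ᵥ-cong (λ u → ∑-*ʳ (allFin n) (square (degree u)) _) ⟩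
        ∑ᵥ (λ u → ∑ᵥ (λ v → ⟦ u Fin.≟ v ⟧) * square (degree u))
          ≤⟨ ∑ᵥ-mono (λ u → *-monoˡ-≤ (square (degree u)) (∑-⟦≟⟧≤1 u)) ⟩
        ∑ᵥ (λ u → 1 * square (degree u))
          ≡⟨ ∑ᵥ-cong (λ u → *-identityˡ _) ⟩
        ∑ᵥ (square ∘ degree) ∎
        where
        factor : ∀ ((u , v) : Fin n × Fin n) →
          ∑ pairs (λ t → degenerate (u , v) t) ≡ ⟦ u Fin.≟ v ⟧ * square (degree u)
        factor (u , v) = trans
          (∑-cong pairs λ (w , x) → trans
            (⟦⟧-×-dec (u Fin.≟ v) (adj? u w ×-dec adj? u x))
            (cong (⟦ u Fin.≟ v ⟧ *_) (⟦⟧-×-dec (adj? u w) (adj? u x))))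
          (trans (∑-*ˡ (pairs {n}) ⟦ u Fin.≟ v ⟧ _)
            (cong (⟦ u Fin.≟ v ⟧ *_)
              (trans (∑-pairs _) (∑-* (allFin n) (allFin n) _ _))))

-- Arithmetic of the dichotomy for one subgraph.

^-distribʳ-* : ∀ k x y → (x * y) ^ k ≡ x ^ k * y ^ k
^-distribʳ-* zero    x y = refl
^-distribʳ-* (suc k) x y = trans (cong (x * y *_) (^-distribʳ-* k x y)) ([m*n]*[o*p]≡[m*o]*[n*p] x y _ _)

-- N, F, X₂, X₄ count the nodes, ordered adjacent pairs, walks of length 2 and
-- closed walks of length 4 of an induced subgraph whose nodes all have degree
-- at least D and at least t in the whole graph, which has m edges and C 4-cycles.
module _ (N D t m F X₂ X₄ C : ℕ)
  (F²≤NX₂ : square F ≤ N * X₂) (X₂²≤N²X₄ : square X₂ ≤ square N * X₄)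
  (X₄≤ : X₄ ≤ 8 * C + 2 * X₂)
  (ND≤2m : N * D ≤ 2 * m) (Nt≤2m : N * t ≤ 2 * m) (m<t³ : m < t ^ 3)
  where

  open ≤-Reasoning
  open +-*-Solver

  private
    cube : ∀ c x → c * x ^ 3 ≡ c * x ^ 2 * x
    cube = solve 2 (λ c x → c :* x :^ 3 := c :* x :^ 2 :* x) refl

    -- This is N³ ≤ 8 m² with a factor `m` kept on both sides, which `few-edges` cancels.
    N³m≤8m³ : N ^ 3 * m ≤ 8 * m ^ 2 * m
    N³m≤8m³ = begin
      N ^ 3 * m          ≤⟨ *-monoʳ-≤ (N ^ 3) (<⇒≤ m<t³) ⟩
      N ^ 3 * t ^ 3      ≡⟨ ^-distribʳ-* 3 N t ⟨
      (N * t) ^ 3        ≤⟨ ^-monoˡ-≤ 3 Nt≤2m ⟩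
      (2 * m) ^ 3        ≡⟨ trans (^-distribʳ-* 3 2 m) (cube 8 m) ⟩
      8 * m ^ 2 * m      ∎

    -- After squaring, (DF)⁶ ≤ 64 D⁶N⁹; the factor D⁶N⁶ is bounded through `ND≤2m` and the remaining
    -- N³ by 8 m².
    few-edges : .{{NonZero m}} → square F ≤ 4 * N ^ 3 → (D * F) ^ 3 ≤ 256 * m ^ 4
    few-edges F²≤4N³ = square-cancel-≤ (begin
      square ((D * F) ^ 3)
        ≡⟨ solve 2 (λ D F → (D :* F) :^ 3 :* (D :* F) :^ 3 := D :^ 6 :* (F :* F) :^ 3) refl D F ⟩
      D ^ 6 * square F ^ 3
        ≤⟨ *-monoʳ-≤ (D ^ 6) (^-monoˡ-≤ 3 F²≤4N³) ⟩
      D ^ 6 * (4 * N ^ 3) ^ 3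
        ≡⟨ cong (D ^ 6 *_) (^-distribʳ-* 3 4 (N ^ 3)) ⟩
      D ^ 6 * (64 * (N ^ 3) ^ 3)
        ≡⟨ regroup 64 D N ⟩
      64 * ((N * D) ^ 6 * N ^ 3)
        ≤⟨ *-monoʳ-≤ 64 (*-mono-≤ (^-monoˡ-≤ 6 ND≤2m) (*-cancelʳ-≤ (N ^ 3) (8 * m ^ 2) m N³m≤8m³)) ⟩
      64 * ((2 * m) ^ 6 * (8 * m ^ 2))
        ≡⟨ cong (λ x → 64 * (x * (8 * m ^ 2))) (^-distribʳ-* 6 2 m) ⟩
      64 * (64 * m ^ 6 * (8 * m ^ 2))
        ≡⟨ collect 64 64 8 m ⟩
      32768 * square (m ^ 4)
        -- 2^15 is rounded up to 2^16, the square of 256.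
        ≤⟨ *-monoˡ-≤ (square (m ^ 4)) {32768} {65536} (≤ᵇ⇒≤ 32768 65536 _) ⟩
      65536 * square (m ^ 4)
        ≡⟨ square-* 256 (m ^ 4) ⟨
      square (256 * m ^ 4) ∎)
      where
      regroup : ∀ c D N → D ^ 6 * (c * (N ^ 3) ^ 3) ≡ c * ((N * D) ^ 6 * N ^ 3)
      regroup = solve 3 (λ c D N → D :^ 6 :* (c :* (N :^ 3) :^ 3)
                                 := c :* ((N :* D) :^ 6 :* N :^ 3)) refl
      collect : ∀ a b c m → a * (b * m ^ 6 * (c * m ^ 2)) ≡ a * b * c * square (m ^ 4)
      collect = solve 4 (λ a b c m → a :* (b :* m :^ 6 :* (c :* m :^ 2))
                                   := a :* b :* c :* (m :^ 4 :* m :^ 4)) refl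
      square-* : ∀ x y → square (x * y) ≡ square x * square y
      square-* = solve 2 (λ x y → x :* y :* (x :* y) := x :* x :* (y :* y)) refl

    -- Here (DF)⁴ ≤ 16 (ND)⁴ C ≤ 256 m⁴ C. If 256 m⁴ is below (DF)³, a factor (DF)³ cancels and
    -- leaves DF ≤ C.
    many-edges : square (square F) ≤ 16 * (N ^ 4 * C) → (D * F) ^ 3 ≤ 256 * m ^ 4 ⊎ D * F ≤ C
    many-edges F⁴≤16N⁴C with (D * F) ^ 3 ≤? 256 * m ^ 4
    ... | yes x³≤M = inj₁ x³≤M
    ... | no  x³≰M = inj₂ (*-cancelˡ-≤ (x ^ 3) {{>-nonZero (≤-<-trans z≤n (≰⇒> x³≰M))}} (begin
      x ^ 3 * x
        ≡⟨ solve 2 (λ D F → (D :* F) :^ 3 :* (D :* F) := D :^ 4 :* (F :* F :* (F :* F))) refl D F ⟩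
      D ^ 4 * square (square F)
        ≤⟨ *-monoʳ-≤ (D ^ 4) F⁴≤16N⁴C ⟩
      D ^ 4 * (16 * (N ^ 4 * C))
        ≡⟨ solve 4 (λ c D N C → D :^ 4 :* (c :* (N :^ 4 :* C))
                             := c :* ((N :* D) :^ 4 :* C)) refl 16 D N C ⟩
      16 * ((N * D) ^ 4 * C)
        ≤⟨ *-monoʳ-≤ 16 (*-monoˡ-≤ C (^-monoˡ-≤ 4 ND≤2m)) ⟩
      16 * ((2 * m) ^ 4 * C)
        ≡⟨ cong (λ x → 16 * (x * C)) (^-distribʳ-* 4 2 m) ⟩
      16 * (16 * m ^ 4 * C)
        ≡⟨ solve 4 (λ a b x C → a :* (b :* x :* C) := a :* b :* x :* C) refl 16 16 (m ^ 4) C ⟩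
      256 * m ^ 4 * C
        ≤⟨ *-monoˡ-≤ C (<⇒≤ (≰⇒> x³≰M)) ⟩
      x ^ 3 * C ∎))
      where
      x = D * F

    -- Doubling `X₄≤` produces the degenerate term 4 N² X₂, which is at most X₂² and hence at most
    -- `Y`; one of the two copies of `Y` then cancels.
    F⁴≤ : 4 * square N ≤ X₂ → square (square F) ≤ 16 * (N ^ 4 * C)
    F⁴≤ 4N²≤X₂ = begin
      square (square F)
        ≤⟨ *-mono-≤ F²≤NX₂ F²≤NX₂ ⟩
      square (N * X₂)
        ≡⟨ solve 2 (λ N X → N :* X :* (N :* X) := N :* N :* (X :* X)) refl N X₂ ⟩
      square N * square X₂
        ≤⟨ *-monoʳ-≤ (square N) (≤-trans X₂²≤N²X₄ Y≤16N²C) ⟩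
      square N * (16 * (square N * C))
        ≡⟨ solve 3 (λ c N C → N :* N :* (c :* (N :* N :* C)) := c :* (N :^ 4 :* C)) refl 16 N C ⟩
      16 * (N ^ 4 * C) ∎
      where
      Y = square N * X₄
      Y≤16N²C : Y ≤ 16 * (square N * C)
      Y≤16N²C = +-cancelʳ-≤ Y Y _ (begin
        Y + Y
          ≤⟨ +-mono-≤ (*-monoʳ-≤ (square N) X₄≤) (*-monoʳ-≤ (square N) X₄≤) ⟩
        square N * (8 * C + 2 * X₂) + square N * (8 * C + 2 * X₂)
          ≡⟨ solve 3 (λ s C X → s :* (con 8 :* C :+ con 2 :* X) :+ s :* (con 8 :* C :+ con 2 :* X)
                             := con 16 :* (s :* C) :+ con 4 :* s :* X) refl (square N) C X₂ ⟩
        16 * (square N * C) + 4 * square N * X₂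
          ≤⟨ +-monoʳ-≤ (16 * (square N * C)) (≤-trans (*-monoˡ-≤ X₂ 4N²≤X₂) X₂²≤N²X₄) ⟩
        16 * (square N * C) + Y ∎)

    F²≤ : X₂ ≤ 4 * square N → square F ≤ 4 * N ^ 3
    F²≤ X₂≤4N² = begin
      square F            ≤⟨ F²≤NX₂ ⟩
      N * X₂              ≤⟨ *-monoʳ-≤ N X₂≤4N² ⟩
      N * (4 * square N)  ≡⟨ solve 1 (λ N → N :* (con 4 :* (N :* N)) := con 4 :* N :^ 3) refl N ⟩
      4 * N ^ 3           ∎

    -- `m < t ^ 3` makes `t` positive, so `Nt≤2m` leaves no nodes.
    m≡0⇒DF≤C : m ≡ 0 → D * F ≤ C
    m≡0⇒DF≤C refl = ≤-trans (≤-reflexive (trans (cong (D *_) F≡0) (*-zeroʳ D))) z≤n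
      where
      N≡0 : N ≡ 0
      N≡0 = m*n≡0⇒m≡0 N t {{t≢0}} (n≤0⇒n≡0 Nt≤2m)
        where
        t≢0 : NonZero t
        t≢0 = ≢-nonZero λ { refl → <⇒≱ m<t³ z≤n }
      F≡0 : F ≡ 0
      F≡0 = n≤0⇒n≡0 (square-cancel-≤ (subst (λ N → square F ≤ N * X₂) N≡0 F²≤NX₂))

  -- The threshold X₂ = 4 N² decides: below it F² ≤ 4 N³, above it the degenerate walks are absorbed
  -- by `F⁴≤`.
  degree-*-edges≤ : (D * F) ^ 3 ≤ 256 * m ^ 4 ⊎ D * F ≤ C
  degree-*-edges≤ with m ≟ 0 | ≤-total X₂ (4 * square N)
  ... | yes m≡0 | _           = inj₂ (m≡0⇒DF≤C m≡0)
  ... | no  m≢0 | inj₁ X₂≤4N² = inj₁ (few-edges {{≢-nonZero m≢0}} (F²≤ X₂≤4N²))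
  ... | no  _   | inj₂ 4N²≤X₂ = many-edges (F⁴≤ 4N²≤X₂)

-- Dyadic decomposition of the paths.

module _ {n : ℕ} (G : Graph n) where
  open Graph G
  open FinSums n

  private
    m C : ℕ
    m = #edges G
    C = #fourCycles G

  HighAbove : ℕ → Pred (Fin n) 0ℓ
  HighAbove D v = High G v × D ≤ deg G v

  highAbove? : ∀ D → Decidable (HighAbove D)
  highAbove? D v = high? G v ×-dec D ≤? deg G v

  module Above (D : ℕ) = InducedSubgraph G (highAbove? D)

  above-edges≤ : ∀ D → let x = D * ∑ᵥ (Above.degree D) in x ^ 3 ≤ 256 * m ^ 4 ⊎ x ≤ C
  -- `t` is the least integer with `m < t ^ 3`, so every high node has degree at least `t`.
  above-edges≤ D = let t , m<t³ , below = least-≥ (_^ 3) (^-monoˡ-< 3) (suc m) in degree-*-edges≤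
    size D t m (∑ᵥ degree) (∑ᵥ (square ∘ degree)) (∑ pairs (square ∘ codegree)) C
    ∑-degree²≤
    (subst (λ x → square x ≤ square size * ∑ pairs (square ∘ codegree)) ∑-codegree ∑-codegree²≤)
    ∑-codegree-square≤
    (size-*-≤ D proj₂)
    (size-*-≤ t λ {v} (high , _) → ≮⇒≥ λ deg<t →
      <⇒≱ (below (deg G v) deg<t) (Equivalence.from (∛<⇔<^3 m (deg G v)) high))
    m<t³
    where open Above D

  module _ (O : Orientation G) where
    open Orientation O

    #LHHPaths≤∑ : ∀ k → n ≤ 2 ^ k →
      #LHHPaths G O ≤ ∑ (downFrom k) λ i → 2 ^ i * ∑ᵥ (Above.degree (2 ^ i))
    #LHHPaths≤∑ k n≤2^k = begin
      #LHHPaths G O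
        ≡⟨ trans (length-filter (isLHHPath? G O) triples) (∑-triples _) ⟩
      ∑ᵥ (λ u → ∑ᵥ λ v → ∑ᵥ λ w → ⟦ isLHHPath? G O (u , v , w) ⟧)
        -- The first node is relaxed to any neighbour of `v`, so a high centre contributes its
        -- degree times the number of its high out-neighbours.
        ≤⟨ ∑ᵥ-mono (λ u → ∑ᵥ-mono λ v → ∑ᵥ-mono λ w → path≤ u v w) ⟩
      ∑ᵥ (λ u → ∑ᵥ λ v → ∑ᵥ λ w → ⟦ v ~? u ⟧ * ⟦ HH? v w ⟧)
        ≡⟨ ∑ᵥ-swap _ ⟩
      ∑ᵥ (λ v → ∑ᵥ λ u → ∑ᵥ λ w → ⟦ v ~? u ⟧ * ⟦ HH? v w ⟧)
        ≡⟨ ∑ᵥ-cong (λ v → ∑-* (allFin n) (allFin n) _ _) ⟩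
      ∑ᵥ (λ v → ∑ᵥ (λ u → ⟦ v ~? u ⟧) * ∑ᵥ λ w → ⟦ HH? v w ⟧)
        ≡⟨ ∑ᵥ-cong (λ v → cong (_* ∑ᵥ λ w → ⟦ HH? v w ⟧) (deg≡∑ G v)) ⟨
      ∑ᵥ (λ v → deg G v * ∑ᵥ λ w → ⟦ HH? v w ⟧)
        ≤⟨ ∑ᵥ-mono (λ v → *-monoˡ-≤ (∑ᵥ λ w → ⟦ HH? v w ⟧)
             (≤-∑-powers k (deg G v) (<-≤-trans (deg<n G v) n≤2^k))) ⟩
      ∑ᵥ (λ v → ∑ (downFrom k) (λ i → ⟦ 2 ^ i ≤? deg G v ⟧ * 2 ^ i) * ∑ᵥ λ w → ⟦ HH? v w ⟧)
        ≡⟨ ∑ᵥ-cong (λ v → ∑-* (downFrom k) (allFin n) _ _) ⟨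
      ∑ᵥ (λ v → ∑ (downFrom k) λ i → ∑ᵥ λ w → ⟦ 2 ^ i ≤? deg G v ⟧ * 2 ^ i * ⟦ HH? v w ⟧)
        ≤⟨ ∑ᵥ-mono (λ v → ∑-mono (downFrom k) λ i → ∑ᵥ-mono λ w → edge≤ i v w) ⟩
      ∑ᵥ (λ v → ∑ (downFrom k) λ i → ∑ᵥ λ w → 2 ^ i * ⟦ Above.adj? (2 ^ i) v w ⟧)
        ≡⟨ ∑ᵥ-cong (λ v → ∑-cong (downFrom k) λ i → ∑-*ˡ (allFin n) (2 ^ i) _) ⟩
      ∑ᵥ (λ v → ∑ (downFrom k) λ i → 2 ^ i * Above.degree (2 ^ i) v)
        ≡⟨ ∑-swap (allFin n) (downFrom k) _ ⟩
      ∑ (downFrom k) (λ i → ∑ᵥ λ v → 2 ^ i * Above.degree (2 ^ i) v)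
        ≡⟨ ∑-cong (downFrom k) (λ i → ∑-*ˡ (allFin n) (2 ^ i) _) ⟩
      ∑ (downFrom k) (λ i → 2 ^ i * ∑ᵥ (Above.degree (2 ^ i))) ∎
      where
      open ≤-Reasoning

      HH? : ∀ v w → Dec (v ⟶ w × High G v × High G w)
      HH? v w = v ⟶? w ×-dec high? G v ×-dec high? G w

      path≤ : ∀ u v w → ⟦ isLHHPath? G O (u , v , w) ⟧ ≤ ⟦ v ~? u ⟧ * ⟦ HH? v w ⟧
      path≤ u v w = subst (⟦ isLHHPath? G O (u , v , w) ⟧ ≤_) (⟦⟧-×-dec (v ~? u) (HH? v w))
        (⟦⟧-mono (isLHHPath? G O (u , v , w)) (v ~? u ×-dec HH? v w)
          λ (_ , u⟶v , v⟶w , _ , Hv , Hw) → ~-sym (⟶⇒~ u⟶v) , v⟶w , Hv , Hw)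

      -- The orientation gives 2^i ≤ deg v ≤ deg w, so both ends of the arc lie in the subgraph of
      -- level `i`.
      edge≤ : ∀ i v w → ⟦ 2 ^ i ≤? deg G v ⟧ * 2 ^ i * ⟦ HH? v w ⟧
                          ≤ 2 ^ i * ⟦ Above.adj? (2 ^ i) v w ⟧
      edge≤ i v w = begin
        ⟦ D≤? ⟧ * 2 ^ i * ⟦ HH? v w ⟧    ≡⟨ swap ⟦ D≤? ⟧ (2 ^ i) ⟦ HH? v w ⟧ ⟩
        2 ^ i * (⟦ D≤? ⟧ * ⟦ HH? v w ⟧)  ≡⟨ cong (2 ^ i *_) (⟦⟧-×-dec D≤? (HH? v w)) ⟨
        2 ^ i * ⟦ D≤? ×-dec HH? v w ⟧
          ≤⟨ *-monoʳ-≤ (2 ^ i) (⟦⟧-mono (D≤? ×-dec HH? v w) (Above.adj? (2 ^ i) v w)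
               λ (D≤v , v⟶w , Hv , Hw) →
                 ⟶⇒~ v⟶w , (Hv , D≤v) , (Hw , ≤-trans D≤v (⟶⇒deg≤ v⟶w))) ⟩
        2 ^ i * ⟦ Above.adj? (2 ^ i) v w ⟧ ∎
        where
        D≤? = 2 ^ i ≤? deg G v
        swap : ∀ x y z → x * y * z ≡ y * (x * z)
        swap = solve-∀

    -- The path count is at most `k` times the largest product, so the dichotomy for that product
    -- carries over.
    #LHHPaths≤ : ∀ k → n ≤ 2 ^ k →
      #LHHPaths G O ^ 3 ≤ k ^ 3 * (256 * m ^ 4) ⊎ #LHHPaths G O ≤ k * C
    #LHHPaths≤ k n≤2^k =
      let y , small , ∑≤ = ∑-≤-length-* {Q = λ y → y ^ 3 ≤ 256 * m ^ 4 ⊎ y ≤ C}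
            (downFrom k) _ (inj₂ z≤n) (λ i → above-edges≤ (2 ^ i))
      in conclude y small (≤-trans (#LHHPaths≤∑ k n≤2^k)
           (≤-trans ∑≤ (≤-reflexive (cong (_* y) (length-downFrom k)))))
      where
      open ≤-Reasoning
      conclude : ∀ y → y ^ 3 ≤ 256 * m ^ 4 ⊎ y ≤ C → #LHHPaths G O ≤ k * y →
        #LHHPaths G O ^ 3 ≤ k ^ 3 * (256 * m ^ 4) ⊎ #LHHPaths G O ≤ k * C
      conclude y (inj₁ y³≤) P≤ky = inj₁ (begin
        #LHHPaths G O ^ 3       ≤⟨ ^-monoˡ-≤ 3 P≤ky ⟩
        (k * y) ^ 3             ≡⟨ ^-distribʳ-* 3 k y ⟩
        k ^ 3 * y ^ 3           ≤⟨ *-monoʳ-≤ (k ^ 3) y³≤ ⟩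
        k ^ 3 * (256 * m ^ 4)   ∎)
      conclude y (inj₂ y≤C) P≤ky = inj₂ (≤-trans P≤ky (*-monoʳ-≤ k y≤C))

-- Rational bounds extracted from upper cuts.

open import Data.Integer using (+_)

ι : ℕ → ℚᵘ
ι k = mkℚᵘ (+ k) 0

ι-* : ∀ x y → ι (x * y) ≡ ι x ℚ.* ι y
ι-* x y = cong (λ z → mkℚᵘ z 0) (ℤ.pos-* x y)

+*+≤⇒*≤ : ∀ p q r s → + p ℤ.* + q ℤ.≤ + r ℤ.* + s → p * q ≤ r * s
+*+≤⇒*≤ p q r s le =
  ℤ.drop‿+≤+ (subst₂ ℤ._≤_ (sym (ℤ.pos-* p q)) (sym (ℤ.pos-* r s)) le)

*≤⇒+*+≤ : ∀ p q r s → p * q ≤ r * s → + p ℤ.* + q ℤ.≤ + r ℤ.* + s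
*≤⇒+*+≤ p q r s le =
  subst₂ ℤ._≤_ (ℤ.pos-* p q) (ℤ.pos-* r s) (ℤ.+≤+ le)

ι-mono-≤ : ∀ {x y} → x ≤ y → ι x ℚ.≤ ι y
ι-mono-≤ {x} {y} x≤y = ℚ.*≤* (*≤⇒+*+≤ x 1 y 1 (*-monoˡ-≤ 1 x≤y))

ι-cancel-*-≤ : ∀ x p q y → ι x ℚ.* mkℚᵘ (+ p) q ℚ.≤ ι y → x * p ≤ y * suc q
ι-cancel-*-≤ x p q y (ℚ.*≤* le) = begin
  x * p                ≡⟨ *-identityʳ (x * p) ⟨
  x * p * 1
    ≤⟨ +*+≤⇒*≤ (x * p) 1 y (suc (q + 0))
         (subst (λ z → z ℤ.* + 1 ℤ.≤ + y ℤ.* + suc (q + 0)) (sym (ℤ.pos-* x p)) le) ⟩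
  y * suc (q + 0)      ≡⟨ cong (λ z → y * suc z) (+-identityʳ q) ⟩
  y * suc q            ∎
  where open ≤-Reasoning

-- If `r` exceeded `ι k`, it would belong to the cut of `k`, hence to its own cut, which is absurd.
fromℚ≤ᵣ⇒≤ : ∀ {r k} → fromℚ r ≤ᵣ fromℕ k → r ℚ.≤ ι k
fromℚ≤ᵣ⇒≤ {r} r≤k = ℚ.≮⇒≥ λ k<r → ℚ.<-irrefl ℚ.≃-refl (r≤k {r} k<r)

-- If `t`, as a fraction p/q, were below `j`, then 2^p ≤ 2^(jq) ≤ n^q, against membership in the
-- cut.
log₂-lower : ∀ j n t → 2 ^ j ≤ n → log₂ n t → ι j ℚ.≤ t
log₂-lower j n (mkℚᵘ (+ p) q) 2^j≤n (_ , n^q<2^p) = ℚ.*≤* (*≤⇒+*+≤ j (suc q) p 1 (begin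
  j * suc q  ≤⟨ ≮⇒≥ (λ p<jq → <⇒≱ 2^jq<2^p (^-monoʳ-≤ 2 (<⇒≤ p<jq))) ⟩
  p          ≡⟨ *-identityʳ p ⟨
  p * 1      ∎))
  where
  open ≤-Reasoning
  2^jq<2^p : 2 ^ (j * suc q) < 2 ^ p
  2^jq<2^p = begin-strict
    2 ^ (j * suc q)  ≡⟨ ^-*-assoc 2 j (suc q) ⟨
    (2 ^ j) ^ suc q  ≤⟨ ^-monoˡ-≤ (suc q) 2^j≤n ⟩
    n ^ suc q        <⟨ n^q<2^p ⟩
    2 ^ p            ∎

ι*ι≤ : ∀ x y {s t} → ι x ℚ.≤ s → ι y ℚ.≤ t → ι (x * y) ℚ.≤ s ℚ.* t
ι*ι≤ x y x≤s y≤t rewrite ι-* x y = ℚ.*-mono-≤-nonNeg x≤s y≤t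

-- The bound j² is lowered to `j`, which matches a number of scales linear in `j`.
log₂²-lower : ∀ j n t → 1 ≤ j → 2 ^ j ≤ n → (log₂ n *ᵣ log₂ n) t → ι j ℚ.≤ t
log₂²-lower j n t 1≤j 2^j≤n (t₁ , t₂ , log<t₁ , log<t₂ , t₁t₂≤t) = begin
  ι j          ≤⟨ ι-mono-≤ (m≤m*n j j {{>-nonZero 1≤j}}) ⟩
  ι (j * j)    ≤⟨ ι*ι≤ j j (log₂-lower j n t₁ 2^j≤n log<t₁) (log₂-lower j n t₂ 2^j≤n log<t₂) ⟩
  t₁ ℚ.* t₂    ≤⟨ t₁t₂≤t ⟩
  t            ∎
  where open ℚ.≤-Reasoning

-- The fraction p/q lies above m^(4/3), so P ≥ 8 k p/q gives P³ ≥ 512 k³ (p/q)³ > 256 k³ m⁴.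
8kp≤Pq⇒P³≰ : ∀ k m P p q .{{_ : NonZero k}} → 8 * k * p ≤ P * q →
  m ^ 4 * q ^ 3 < p ^ 3 → ¬ P ^ 3 ≤ k ^ 3 * (256 * m ^ 4)
8kp≤Pq⇒P³≰ k m P p q 8kp≤Pq m⁴q³<p³ P³≤ =
  <⇒≱ (*-monoʳ-< (k ^ 3) {{m^n≢0 k 3}} (*-monoʳ-< 256 m⁴q³<p³)) (begin
    k ^ 3 * (256 * p ^ 3)
      ≤⟨ *-monoʳ-≤ (k ^ 3) (*-monoˡ-≤ (p ^ 3) {256} {512} (≤ᵇ⇒≤ 256 512 _)) ⟩
    k ^ 3 * (512 * p ^ 3)
      ≡⟨ swap (k ^ 3) 512 (p ^ 3) ⟩
    512 * k ^ 3 * p ^ 3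
      ≡⟨ trans (^-distribʳ-* 3 (8 * k) p) (cong (_* p ^ 3) (^-distribʳ-* 3 8 k)) ⟨
    (8 * k * p) ^ 3
      ≤⟨ ^-monoˡ-≤ 3 8kp≤Pq ⟩
    (P * q) ^ 3
      ≡⟨ ^-distribʳ-* 3 P q ⟩
    P ^ 3 * q ^ 3
      ≤⟨ *-monoˡ-≤ (q ^ 3) P³≤ ⟩
    k ^ 3 * (256 * m ^ 4) * q ^ 3
      ≡⟨ regroup (k ^ 3) 256 (m ^ 4) (q ^ 3) ⟩
    k ^ 3 * (256 * (m ^ 4 * q ^ 3)) ∎)
  where
  open ≤-Reasoning
  swap : ∀ x y z → x * (y * z) ≡ y * x * z
  swap = solve-∀
  regroup : ∀ x y z w → x * (y * z) * w ≡ x * (y * (z * w))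
  regroup = solve-∀

xys≤ab : ∀ x y s a b →
  .{{_ : ℚ.NonNegative x}} .{{_ : ℚ.NonNegative y}} .{{_ : ℚ.NonNegative s}} →
  x ℚ.* s ℚ.≤ a → y ℚ.≤ b → x ℚ.* y ℚ.* s ℚ.≤ a ℚ.* b
xys≤ab x y s a b xs≤a y≤b = begin
  x ℚ.* y ℚ.* s    ≃⟨ ℚ.*-assoc x y s ⟩
  x ℚ.* (y ℚ.* s)  ≃⟨ ℚ.*-congˡ {x} (ℚ.*-comm y s) ⟩
  x ℚ.* (s ℚ.* y)  ≃⟨ ℚ.*-assoc x s y ⟨
  x ℚ.* s ℚ.* y    ≤⟨ ℚ.*-mono-≤-nonNeg {{ℚ.nonNeg*nonNeg⇒nonNeg x s}} xs≤a y≤b ⟩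
  a ℚ.* b          ∎
  where open ℚ.≤-Reasoning

bound<P⇒P³≰ : ∀ j m n P → 1 ≤ j → 2 ^ j ≤ n →
  fromℕ 100 *ᵣ m ^[ 4 / 3 ] *ᵣ (log₂ n *ᵣ log₂ n) <ᵣ fromℕ P →
  ¬ P ^ 3 ≤ (2 * j) ^ 3 * (256 * m ^ 4)
bound<P⇒P³≰ j m n P 1≤j 2^j≤n
  (r , (a , b , (s , mkℚᵘ (+ p) q , 100<s , (_ , m⁴q³<p³) , s*≤a) , log²<b , ab≤r) , r≤P) =
  -- With k = 2 j the required factor is 8 k = 16 j, supplied by 100 log² n because 100 ≥ 16 and
  -- log² n ≥ j.
  8kp≤Pq⇒P³≰ (2 * j) m P p (suc q) {{m*n≢0 2 j {{_}} {{>-nonZero 1≤j}}}}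
    (≤-trans (≤-reflexive (cong (_* p) (sym (*-assoc 8 2 j))))
      (ι-cancel-*-≤ (16 * j) p q P 16js₂≤P))
    m⁴q³<p³
  where
  s₂ : ℚᵘ
  s₂ = mkℚᵘ (+ p) q
  16s₂≤a : ι 16 ℚ.* s₂ ℚ.≤ a
  16s₂≤a = ℚ.≤-trans
    (ℚ.*-monoˡ-≤-nonNeg s₂ (ℚ.≤-trans (ι-mono-≤ (≤ᵇ⇒≤ 16 100 _)) (ℚ.<⇒≤ 100<s))) s*≤a
  16js₂≤P : ι (16 * j) ℚ.* s₂ ℚ.≤ ι P
  16js₂≤P = subst (λ x → x ℚ.* s₂ ℚ.≤ ι P) (sym (ι-* 16 j))
    (ℚ.≤-trans (xys≤ab (ι 16) (ι j) s₂ a b 16s₂≤a (log₂²-lower j n b 1≤j 2^j≤n log²<b))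
      (ℚ.≤-trans ab≤r (fromℚ≤ᵣ⇒≤ {r} r≤P)))

*-≤⇒positive : ∀ x y z → ℚ.Positive x → ℚ.Positive y → x ℚ.* y ℚ.≤ z → ℚ.Positive z
*-≤⇒positive x y z x-pos y-pos xy≤z = ℚ.positive
  (ℚ.<-≤-trans (ℚ.positive⁻¹ (x ℚ.* y) {{ℚ.pos*pos⇒pos x {{x-pos}} y {{y-pos}}}}) xy≤z)

-- Serves the case `n ≤ 1`, where log₂ n is 0: all members of the cuts involved are positive, so
-- some positive rational is at most `P`.
bound<P⇒P≰0 : ∀ m n P →
  fromℕ 100 *ᵣ m ^[ 4 / 3 ] *ᵣ (log₂ n *ᵣ log₂ n) <ᵣ fromℕ P → ¬ P ≤ 0
bound<P⇒P≰0 m n P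
  (r , (a , b , (s , s₂ , 100<s , (s₂-pos , _) , s*≤a)
      , (t₁ , t₂ , (t₁-pos , _) , (t₂-pos , _) , t₁t₂≤b) , ab≤r) , r≤P) P≤0 =
  ℚ.<⇒≱ (ℚ.positive⁻¹ r {{r-pos}}) (ℚ.≤-trans (fromℚ≤ᵣ⇒≤ {r} r≤P) (ι-mono-≤ P≤0))
  where
  s-pos : ℚ.Positive s
  s-pos = ℚ.positive (ℚ.≤-<-trans (ι-mono-≤ z≤n) 100<s)
  r-pos : ℚ.Positive r
  r-pos = *-≤⇒positive a b r
    (*-≤⇒positive s s₂ a s-pos s₂-pos s*≤a) (*-≤⇒positive t₁ t₂ b t₁-pos t₂-pos t₁t₂≤b) ab≤r

-- For rational s > C the separating rational is 2 j s: it exceeds P because P ≤ 2 j C, and is at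
-- most s times 100 log² n because log² n ≥ j.
P/≤C : ∀ j n P C → 1 ≤ j → 2 ^ j ≤ n → P ≤ 2 * j * C →
  fromℕ P /ᵣ (fromℕ 100 *ᵣ (log₂ n *ᵣ log₂ n)) ≤ᵣ fromℕ C
P/≤C j n P C 1≤j 2^j≤n P≤2jC {s} C<s =
  s-pos , ι (2 * j) ℚ.* s , P<2js , λ {t} → below {t}
  where
  open ℚ.≤-Reasoning
  s-pos : ℚ.Positive s
  s-pos = ℚ.positive (ℚ.≤-<-trans (ι-mono-≤ {0} {C} z≤n) C<s)
  instance
    2j-pos : ℚ.Positive (ι (2 * j))
    2j-pos = ℚ.positive (ℚ.<-≤-trans (ℚ.*<* (ℤ.+<+ z<s)) (ι-mono-≤ (≤-trans 1≤j (m≤n*m j 2))))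
    s-nonNeg : ℚ.NonNegative s
    s-nonNeg = ℚ.pos⇒nonNeg s {{s-pos}}
  P<2js : ι P ℚ.< ι (2 * j) ℚ.* s
  P<2js = begin-strict
    ι P                  ≤⟨ ι-mono-≤ P≤2jC ⟩
    ι (2 * j * C)        ≡⟨ ι-* (2 * j) C ⟩
    ι (2 * j) ℚ.* ι C    <⟨ ℚ.*-monoʳ-<-pos (ι (2 * j)) C<s ⟩
    ι (2 * j) ℚ.* s      ∎
  below : ∀ {t} → (fromℚ s *ᵣ (fromℕ 100 *ᵣ (log₂ n *ᵣ log₂ n))) t → ι (2 * j) ℚ.* s ℚ.< t
  below {t} (s′ , y , s<s′ , (h , l , 100<h , log²<l , hl≤y) , s′y≤t) = begin-strict
    ι (2 * j) ℚ.* s    <⟨ ℚ.*-monoʳ-<-pos (ι (2 * j)) s<s′ ⟩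
    ι (2 * j) ℚ.* s′   ≃⟨ ℚ.*-comm (ι (2 * j)) s′ ⟩
    s′ ℚ.* ι (2 * j)
      ≤⟨ ℚ.*-monoʳ-≤-nonNeg s′ (begin
           ι (2 * j)      ≤⟨ ι-mono-≤ (*-monoˡ-≤ j (≤ᵇ⇒≤ 2 100 _)) ⟩
           ι (100 * j)    ≤⟨ ι*ι≤ 100 j (ℚ.<⇒≤ 100<h) (log₂²-lower j n l 1≤j 2^j≤n log²<l) ⟩
           h ℚ.* l        ≤⟨ hl≤y ⟩
           y              ∎) ⟩
    s′ ℚ.* y           ≤⟨ s′y≤t ⟩
    t                  ∎
    where
    instance
      s′-nonNeg : ℚ.NonNegative s′
      s′-nonNeg = ℚ.nonNegative (ℚ.≤-trans (ℚ.nonNegative⁻¹ s) (ℚ.<⇒≤ s<s′))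

-- Choice of the number of dyadic scales.

theorem2 :
    ∀ (n : ℕ) (G : Graph n) (O : Orientation G) →
    let m = #edges G
        P = #LHHPaths G O
    in
    fromℕ 100 *ᵣ m ^[ 4 / 3 ] *ᵣ (log₂ n *ᵣ log₂ n) <ᵣ fromℕ P →
    fromℕ P /ᵣ (fromℕ 100 *ᵣ (log₂ n *ᵣ log₂ n)) ≤ᵣ fromℕ (#fourCycles G)
theorem2 n G O hyp = conclude (least-≥ (2 ^_) (^-monoʳ-< 2 (s≤s (s≤s z≤n))) (suc n))
  where
  m #P C : ℕ
  m = #edges G
  #P = #LHHPaths G O
  C = #fourCycles G

  Goal : Set
  Goal = fromℕ #P /ᵣ (fromℕ 100 *ᵣ (log₂ n *ᵣ log₂ n)) ≤ᵣ fromℕ C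

  no-paths : n ≤ 1 → Goal
  -- With 0 scales, allowed since `n ≤ 2 ^ 0`, either alternative forces P = 0.
  no-paths n≤1 = contradiction
    ([ (λ #P³≤0 → ≤-reflexive (m^n≡0⇒m≡0 #P 3 (n≤0⇒n≡0 #P³≤0))) , id ]′ (#LHHPaths≤ G O 0 n≤1))
    (bound<P⇒P≰0 m n #P hyp)

  dichotomy : ∀ j → 1 ≤ j → 2 ^ j ≤ n →
    #P ^ 3 ≤ (2 * j) ^ 3 * (256 * m ^ 4) ⊎ #P ≤ 2 * j * C → Goal
  dichotomy j 1≤j 2^j≤n (inj₁ #P³≤)   = contradiction #P³≤ (bound<P⇒P³≰ j m n #P 1≤j 2^j≤n hyp)
  dichotomy j 1≤j 2^j≤n (inj₂ #P≤2jC) = P/≤C j n #P C 1≤j 2^j≤n #P≤2jC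

  conclude : ∃[ k ] n < 2 ^ k × (∀ j → j < k → 2 ^ j < suc n) → Goal
  conclude (0 , n<1 , _) = no-paths (<⇒≤ n<1)
  conclude (1 , n<2 , _) = no-paths (s≤s⁻¹ n<2)
  -- j = `suc i` is ⌊log₂ n⌋ ≥ 1. The number of scales j + 1 is rounded up to 2 j, a multiple of the
  -- lower bound j for log² n.
  conclude (suc (suc i) , n<2^k , below) =
    dichotomy (suc i) (s≤s z≤n) (s≤s⁻¹ (below (suc i) ≤-refl))
      (#LHHPaths≤ G O (2 * suc i) (≤-trans (<⇒≤ n<2^k) (^-monoʳ-≤ 2 k≤2j)))
    where
    k≤2j : suc (suc i) ≤ 2 * suc i
    k≤2j = subst (_≤ 2 * suc i) (+-comm (suc i) 1) (+-monoʳ-≤ (suc i) (s≤s z≤n))
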